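{- Let $d\ge 2$, and let $a=(a_0,a_1,a_2,\ldots)$ be an eventually periodic binary sequence (with entries in $\mathbb F_2$). For each $h\ge 0$ let $\varepsilon_h$ be the depth-dependent labeling of the complete rooted $d$-ary tree $T_h^{(d)}$ induced by $a$. Then the sequence of boundary affine subspaces \[ L_{T_h^{(d)}}\subseteq\mathbb F_2^2\qquad(h=0,1,2,\ldots) \] is eventually periodic in $h$. Moreover, there exist integers $h_0\ge 0$ and $p\ge 1$ such that, for each residue class $r$ modulo $p$, there are rational constants $c_r,b_r$ satisfying \[ \operatorname{null} M(T_h^{(d)},\varepsilon_h)=c_r d^h+b_r \] for all $h\ge h_0$ with $h\equiv r\pmod p$.
   Context: All matrices and vector spaces are over the two-element field $\mathbb F_2$, and $\operatorname{null}(M)=\dim\ker(M)$. $T_h^{(d)}$ is the complete rooted $d$-ary tree of height $h$: every non-leaf vertex has exactly $d$ children and every root-to-leaf path has length $h$. The depth-dependent labeling $\varepsilon_h$ of $T_h^{(d)}$ associated with $a$ assigns label $a_j$ to every vertex whose descendant subtree has height $j$; thus leaves receive label $a_0$, their parents $a_1$, and the root $a_h$. For a finite rooted tree $T$ with root $r$ and labeling $\varepsilon:V(T)\to\mathbb F_2$, put $M(T,\varepsilon)=A(T)+D_\varepsilon$, where $A(T)$ is the adjacency matrix over $\mathbb F_2$ and $D_\varepsilon$ is the diagonal matrix with diagonal vector $\varepsilon$, and for $\alpha,\beta\in\mathbb F_2$ define \[ N_T(\alpha,\beta)=\#\{x\in\mathbb F_2^{V(T)} : M(T,\varepsilon)x=\varepsilon+\alpha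 e_r,\ x_r=\beta\}, \] with $e_r$ the standard basis vector at $r$. The boundary affine subspace of $T$ (with labeling $\varepsilon$) is $L_T=\{(\alpha,\beta)\in\mathbb F_2^2 : N_T(\alpha,\beta)\neq 0\}$; it is a nonempty affine subspace of $\mathbb F_2^2$, and there is an integer $k\ge 0$ with $N_T(\alpha,\beta)=2^k$ for all $(\alpha,\beta)\in L_T$. Here $L_{T_h^{(d)}}$ is taken with respect to the labeling $\varepsilon_h$. A sequence $(s_h)_{h\ge 0}$ is eventually periodic if there are $H\ge 0$ and $q\ge 1$ with $s_{h+q}=s_h$ for all $h\ge H$. -}

module Defs where

open import Level using (Level; 0ℓ)
open import Data.Bool.Base using (if_then_else_)
open import Data.Fin.Base using (Fin)
import Data.Fin.Properties as Fin
open import Data.Integer.Base using (+_)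
open import Data.List.Base as List using (List; []; _∷_; _++_; foldr; filter; length; allFin; concatMap)
open import Data.Maybe.Base as Maybe using (Maybe; just; nothing)
import Data.Maybe.Properties as Maybe
open import Data.Nat.Base as ℕ using (ℕ; zero; suc; ∣_-_∣)
open import Data.Nat.Divisibility using (_∣_)
open import Data.Parity.Base as ℙ using (Parity; 0ℙ; 1ℙ)
import Data.Parity.Properties as ℙ
open import Data.Product using (_×_; _,_; ∃-syntax; Σ-syntax)
open import Data.Rational.Base as ℚ using (ℚ)
import Data.Vec.Functional as Vec
open import Function.Base using (_∘_)
open import Relation.Binary.Core using (Rel)
open import Relation.Binary.Definitions using (DecidableEquality)
open import Relation.Binary.PropositionalEquality using (_≡_; _≢_; _≗_; refl)
open import Relation.Nullary.Decidable using (Dec; yes; no; map′; _×-dec_; _⊎-dec_; does)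
open import Relation.Unary using (Pred; Decidable)
open import Algebra.Properties.CommutativeMonoid.Sum ℙ.+-0-commutativeMonoid using (sum)

private
  variable
    ℓ ℓ′ : Level

-- The field with two elements; addition and multiplication are those of
-- `Data.Parity`.  Both are declared at the same precedence there.
𝔽₂ : Set
𝔽₂ = Parity

⟦_⟧ : {P : Set ℓ} → Dec P → 𝔽₂
⟦ P? ⟧ = if does P? then 1ℙ else 0ℙ

------------------------------------------------------------------------
-- Finite rooted trees

data Tree : Set where
  node : (k : ℕ) → (Fin k → Tree) → Tree

data Vertex : Tree → Set where
  root  : ∀ {t} → Vertex t
  child : ∀ {k ts} (i : Fin k) → Vertex (ts i) → Vertex (node k ts)

child-injectiveʳ : ∀ {k ts} {i : Fin k} {u v : Vertex (ts i)} →
                   _≡_ {A = Vertex (node k ts)} (child i u) (child i v) → u ≡ v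
child-injectiveʳ refl = refl

infix 4 _≟ᵥ_

_≟ᵥ_ : ∀ {t} → DecidableEquality (Vertex t)
root ≟ᵥ root = yes refl
root ≟ᵥ child _ _ = no λ ()
child _ _ ≟ᵥ root = no λ ()
child i u ≟ᵥ child j v with i Fin.≟ j
... | no  i≢j  = no λ { refl → i≢j refl }
... | yes refl = map′ (λ { refl → refl }) child-injectiveʳ (u ≟ᵥ v)

-- Every vertex of `t` occurs exactly once in this list.
vertices : (t : Tree) → List (Vertex t)
vertices (node k ts) =
  root ∷ concatMap (λ i → List.map (child i) (vertices (ts i))) (allFin k)

allVertices? : ∀ t {P : Pred (Vertex t) ℓ} → Decidable P → Dec (∀ v → P v)
allVertices? (node k ts) P? =
  map′ (λ { (p , ps) root → p ; (p , ps) (child i v) → ps i v })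
       (λ p → p root , λ i v → p (child i v))
       (P? root ×-dec Fin.all? (λ i → allVertices? (ts i) (P? ∘ child i)))

parent : ∀ {t} → Vertex t → Maybe (Vertex t)
parent root        = nothing
parent (child i v) = just (Maybe.maybe′ (child i) root (parent v))

subtree : ∀ {t} → Vertex t → Tree
subtree {t} root    = t
subtree (child i v) = subtree v

height : Tree → ℕ
height (node k ts) = Vec.foldr ℕ._⊔_ 0 (λ i → suc (height (ts i)))

complete : (d h : ℕ) → Tree
complete d zero    = node 0 λ ()
complete d (suc h) = node d λ _ → complete d h

------------------------------------------------------------------------
-- Vectors and matrices over 𝔽₂ indexed by the vertices of a tree

-- Vectors are compared with pointwise equality `_≗_`.
Vector : Tree → Set
Vector t = Vertex t → 𝔽₂

Matrix : Tree → Set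
Matrix t = Vertex t → Vertex t → 𝔽₂

module _ {t : Tree} where

  𝟎 : Vector t
  𝟎 _ = 0ℙ

  infixl 6 _⊕_
  infixr 7 _·_ _*ᵥ_

  _⊕_ : Vector t → Vector t → Vector t
  (x ⊕ y) v = x v ℙ.+ y v

  _·_ : 𝔽₂ → Vector t → Vector t
  (α · x) v = α ℙ.* x v

  e : Vertex t → Vector t
  e u v = ⟦ u ≟ᵥ v ⟧

  _*ᵥ_ : Matrix t → Vector t → Vector t
  (M *ᵥ x) u = foldr ℙ._+_ 0ℙ (List.map (λ v → M u v ℙ.* x v) (vertices t))

  ker : Matrix t → Pred (Vector t) 0ℓ
  ker M x = M *ᵥ x ≗ 𝟎

  linComb : ∀ {n} → (Fin n → 𝔽₂) → (Fin n → Vector t) → Vector t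
  linComb c b v = sum (λ i → c i ℙ.* b i v)

  record IsBasis (U : Pred (Vector t) ℓ) {n} (b : Fin n → Vector t) : Set ℓ where
    field
      belongs     : ∀ i → U (b i)
      independent : ∀ c → linComb c b ≗ 𝟎 → ∀ i → c i ≡ 0ℙ
      spans       : ∀ x → U x → ∃[ c ] linComb c b ≗ x

  HasDimension : Pred (Vector t) ℓ → ℕ → Set ℓ
  HasDimension U n = Σ[ b ∈ (Fin n → Vector t) ] IsBasis U b

  -- `null M ≡ n`, as a relation; `n` is determined by `M` because any two
  -- bases of a finite-dimensional space have the same size.
  Nullity : Matrix t → ℕ → Set
  Nullity M n = HasDimension (ker M) n

-- All vectors, each exactly once up to `_≗_`: the sums of `e v` over the
-- subsets of the vertex set.
vectors : (t : Tree) → List (Vector t)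
vectors t = foldr (λ v xs → xs ++ List.map (e v ⊕_) xs) (𝟎 ∷ []) (vertices t)

------------------------------------------------------------------------
-- The matrix A(T) + D_ε and the boundary affine subspace

Labeling : Tree → Set
Labeling = Vector

module _ (t : Tree) where

  adjacency : Matrix t
  adjacency u v =
    ⟦ Maybe.≡-dec _≟ᵥ_ (parent u) (just v) ⊎-dec Maybe.≡-dec _≟ᵥ_ (parent v) (just u) ⟧

  diagonal : Labeling t → Matrix t
  diagonal ε u v = ⟦ u ≟ᵥ v ⟧ ℙ.* ε u

  M : Labeling t → Matrix t
  M ε u v = adjacency u v ℙ.+ diagonal ε u v

  IsSolution : Labeling t → 𝔽₂ → 𝔽₂ → Pred (Vector t) 0ℓ
  IsSolution ε α β x = (M ε *ᵥ x ≗ ε ⊕ α · e root) × x root ≡ β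

  isSolution? : ∀ ε α β → Decidable (IsSolution ε α β)
  isSolution? ε α β x =
    allVertices? t (λ v → (M ε *ᵥ x) v ℙ.≟ (ε ⊕ α · e root) v) ×-dec (x root ℙ.≟ β)

  N : Labeling t → 𝔽₂ → 𝔽₂ → ℕ
  N ε α β = length (filter (isSolution? ε α β) (vectors t))

  L : Labeling t → Pred (𝔽₂ × 𝔽₂) 0ℓ
  L ε (α , β) = N ε α β ≢ 0

depthLabeling : (ℕ → 𝔽₂) → (t : Tree) → Labeling t
depthLabeling a t v = a (height (subtree v))

------------------------------------------------------------------------
-- Sequences and arithmetic

EventuallyPeriodic : {A : Set ℓ} → Rel A ℓ′ → (ℕ → A) → Set ℓ′
EventuallyPeriodic _≈_ s =
  ∃[ H ] ∃[ q ] 1 ℕ.≤ q × (∀ h → H ℕ.≤ h → s (h ℕ.+ q) ≈ s h)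

infix 4 _≡_mod_

_≡_mod_ : ℕ → ℕ → ℕ → Set
m ≡ n mod p = p ∣ ∣ m - n ∣

fromℕ : ℕ → ℚ
fromℕ n = + n ℚ./ 1

{-# OPTIONS --safe #-}

-- Consider the system M x = μ ε + α e_r, x_r = β: for μ = 1 it defines L_T, for μ = α = 0 the kernel.
-- The solvable boundary values (α , β) at height h always form a line on which α, β or α + β equals
-- μ c, with the form and c independent of μ, and the line at height h + 1 is a function of the line
-- at height h and of a_{h+1}.  This is an automaton with six states driven by an eventually
-- periodic input, so the lines are eventually periodic.
--
-- Let z_h be the dimension of the space of kernel vectors that vanish at the root.  A vector of the
-- kernel can be nonzero at the root only if the line is of the form α = c.  In that case the
-- nullity is z_h + 1 and z_{h+1} = d z_h + (d - 1), where d - 1 accounts for the freedom of the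
-- root values of the children, whose sum must vanish.  Otherwise the nullity is z_h and
-- z_{h+1} = d z_h.  An affine recurrence with an eventually periodic inhomogeneity has solutions
-- c_r d^h + b_r.

module Submission where

open import Defs
open import Data.Bool.Base using (if_then_else_)
open import Data.Fin.Base as Fin using (Fin; zero; suc; toℕ; _↑ˡ_; _↑ʳ_; combine; remQuot)
import Data.Fin.Properties as Fin
import Data.Integer.Base as ℤ
import Data.Integer.Properties as ℤ
open import Data.List.Base as List using (List; []; _∷_; _++_; concatMap; tabulate)
open import Data.List.Membership.Propositional using (_∈_; lose)
import Data.List.Membership.Propositional.Properties as List
import Data.List.Properties as List
open import Data.List.Relation.Unary.Any using (here; there)
open import Data.Maybe.Base as Maybe using (Maybe; just; nothing)
import Data.Maybe.Properties as Maybe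
open import Data.Nat.Base as ℕ using (ℕ; zero; suc; _≤_; _^_)
open import Data.Nat.Divisibility using (divides)
import Data.Nat.Properties as ℕ
open import Data.Nat.Tactic.RingSolver using (solve-∀)
open import Data.Parity.Base as ℙ using (0ℙ; 1ℙ)
import Data.Parity.Properties as ℙ
open import Data.Product using (_×_; _,_; proj₁; proj₂; ∃-syntax; Σ-syntax; uncurry)
open import Data.Rational.Base as ℚ using (ℚ; _+_; _*_)
import Data.Rational.Properties as ℚ
open import Data.Rational.Solver using (module +-*-Solver)
open import Data.Rational.Unnormalised.Base as ℚᵘ using (mkℚᵘ; *≡*)
import Data.Rational.Unnormalised.Properties as ℚᵘ
open import Data.Sum.Base as Sum using (_⊎_; inj₁; inj₂; [_,_]′)
import Data.Vec.Functional as Vec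
import Data.Vec.Functional.Properties as Vec
open import Function.Base using (_∘_; id)
open import Function.Bundles using (_⇔_; mk⇔; Equivalence)
open import Function.Construct.Composition using (_⇔-∘_)
open import Level using (0ℓ)
open import Relation.Binary.PropositionalEquality
open import Relation.Nullary.Decidable using
  (Dec; yes; no; does; dec-false; does-⇔; map′; toWitness; _×-dec_; _⊎-dec_; _→-dec_)
open import Relation.Nullary.Negation using (¬_; contradiction)
open import Relation.Unary using (Pred; Decidable; _≐_)
open import Algebra.Properties.Semiring.Sum ℙ.+-*-semiring
  using (sum; sum-cong-≗; sum-replicate-zero; ∑-distrib-+; *-distribʳ-sum)

open ≡-Reasoning
open Equivalence using (to; from)
open +-*-Solver using (con; _:+_; _:*_; _:-_; :-_; _:=_)

private
  variable
    k m n : ℕ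
    t : Tree

-- Indicators, and identities over 𝔽₂ by exhaustion

⟦⟧-false : {P : Set} (P? : Dec P) → ¬ P → ⟦ P? ⟧ ≡ 0ℙ
⟦⟧-false P? ¬p = cong (if_then 1ℙ else 0ℙ) (dec-false P? ¬p)

⟦⟧-cong : {P Q : Set} → P ⇔ Q → (P? : Dec P) (Q? : Dec Q) → ⟦ P? ⟧ ≡ ⟦ Q? ⟧
⟦⟧-cong P⇔Q P? Q? = cong (if_then 1ℙ else 0ℙ) (does-⇔ P⇔Q P? Q?)

-- Two elements make every identity or equivalence in finitely many variables decidable by
-- evaluation. Below, `toWitness` extracts such proofs, the two sides being inferred from the
-- signature.
∀ℙ? : {P : Pred 𝔽₂ 0ℓ} → Decidable P → Dec (∀ p → P p)
∀ℙ? P? = map′ (λ { (p₀ , p₁) 0ℙ → p₀ ; (p₀ , p₁) 1ℙ → p₁ }) (λ p → p 0ℙ , p 1ℙ) (P? 0ℙ ×-dec P? 1ℙ)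

infix 2 _⇔?_
_⇔?_ : {P Q : Set} → Dec P → Dec Q → Dec (P ⇔ Q)
P? ⇔? Q? = map′ (uncurry mk⇔) (λ P⇔Q → to P⇔Q , from P⇔Q) ((P? →-dec Q?) ×-dec (Q? →-dec P?))

x+y+y≡x : ∀ x y → (x ℙ.+ y) ℙ.+ y ≡ x
x+y+y≡x = toWitness {a? = ∀ℙ? λ x → ∀ℙ? λ y → _ ℙ.≟ _} _

+-interchange : ∀ w x y z → (w ℙ.+ x) ℙ.+ (y ℙ.+ z) ≡ (w ℙ.+ y) ℙ.+ (x ℙ.+ z)
+-interchange = toWitness {a? = ∀ℙ? λ w → ∀ℙ? λ x → ∀ℙ? λ y → ∀ℙ? λ z → _ ℙ.≟ _} _

-- Sums over 𝔽₂

sum-zero : (f : Fin n → 𝔽₂) → (∀ i → f i ≡ 0ℙ) → sum f ≡ 0ℙ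
sum-zero {n} f f≡0 = trans (sum-cong-≗ f≡0) (sum-replicate-zero n)

sum-δ : (f : Fin n → 𝔽₂) (j : Fin n) → sum (λ i → f i ℙ.* ⟦ i Fin.≟ j ⟧) ≡ f j
sum-δ f zero = begin
  (f zero ℙ.* 1ℙ) ℙ.+ sum (λ i → f (suc i) ℙ.* 0ℙ)
    ≡⟨ cong₂ ℙ._+_ (ℙ.*-identityʳ (f zero)) (sum-zero _ (ℙ.*-zeroʳ ∘ f ∘ suc)) ⟩
  f zero ℙ.+ 0ℙ
    ≡⟨ ℙ.+-identityʳ (f zero) ⟩
  f zero ∎
sum-δ f (suc j) = begin
  (f zero ℙ.* 0ℙ) ℙ.+ sum (λ i → f (suc i) ℙ.* ⟦ i Fin.≟ j ⟧)
    ≡⟨ cong₂ ℙ._+_ (ℙ.*-zeroʳ (f zero)) (sum-δ (f ∘ suc) j) ⟩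
  f (suc j) ∎

⟦≟⟧-sym : (i j : Fin n) → ⟦ i Fin.≟ j ⟧ ≡ ⟦ j Fin.≟ i ⟧
⟦≟⟧-sym i j = ⟦⟧-cong (mk⇔ sym sym) (i Fin.≟ j) (j Fin.≟ i)

sum-++ : (f : Fin (m ℕ.+ n) → 𝔽₂) →
         sum f ≡ sum (λ i → f (i ↑ˡ n)) ℙ.+ sum (λ j → f (m ↑ʳ j))
sum-++ {zero}  f = refl
sum-++ {suc m} f = trans (cong (f zero ℙ.+_) (sum-++ {m} (f ∘ suc))) (sym (ℙ.+-assoc (f zero) _ _))

sum-combine : (f : Fin (m ℕ.* n) → 𝔽₂) →
              sum f ≡ sum (λ (i : Fin m) → sum (λ (j : Fin n) → f (combine i j)))
sum-combine {zero}      f = refl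
sum-combine {suc m} {n} f = trans (sum-++ {n} f)
  (cong (sum (λ j → f (j ↑ˡ m ℕ.* n)) ℙ.+_) (sum-combine {m} (λ i → f (n ↑ʳ i))))

sum-constant : ∀ n c → sum {n} (λ _ → c) ≡ sum {n} (λ _ → 1ℙ) ℙ.* c
sum-constant n c = sym (*-distribʳ-sum {n} c (λ _ → 1ℙ))

-- Sums over lists and over the vertices of a tree

∑ : List 𝔽₂ → 𝔽₂
∑ = List.foldr ℙ._+_ 0ℙ

∑-++ : ∀ xs ys → ∑ (xs ++ ys) ≡ ∑ xs ℙ.+ ∑ ys
∑-++ []       ys = refl
∑-++ (x ∷ xs) ys = trans (cong (x ℙ.+_) (∑-++ xs ys)) (sym (ℙ.+-assoc x (∑ xs) (∑ ys)))

∑-map-+ : {A : Set} (f g : A → 𝔽₂) (xs : List A) →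
          ∑ (List.map (λ x → f x ℙ.+ g x) xs) ≡ ∑ (List.map f xs) ℙ.+ ∑ (List.map g xs)
∑-map-+ f g []       = refl
∑-map-+ f g (x ∷ xs) = trans (cong ((f x ℙ.+ g x) ℙ.+_) (∑-map-+ f g xs)) (+-interchange (f x) (g x) _ _)

∑-map-zero : {A : Set} {f : A → 𝔽₂} → (∀ x → f x ≡ 0ℙ) → ∀ xs → ∑ (List.map f xs) ≡ 0ℙ
∑-map-zero f≡0 []       = refl
∑-map-zero f≡0 (x ∷ xs) = cong₂ ℙ._+_ (f≡0 x) (∑-map-zero f≡0 xs)

-- Needed because `vertices` is built from `allFin k`, that is `tabulate id`. The induction requires
-- an arbitrary `h`, since the tail is tabulated from `h ∘ suc`.
∑-concatMap-tabulate : {A B : Set} (f : B → 𝔽₂) (g : A → List B) (h : Fin k → A) →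
  ∑ (List.map f (concatMap g (tabulate h))) ≡ sum (λ i → ∑ (List.map f (g (h i))))
∑-concatMap-tabulate {zero}  f g h = refl
∑-concatMap-tabulate {suc k} f g h = begin
  ∑ (List.map f (g (h zero) ++ gs))
    ≡⟨ cong ∑ (List.map-++ f (g (h zero)) gs) ⟩
  ∑ (List.map f (g (h zero)) ++ List.map f gs)
    ≡⟨ ∑-++ (List.map f (g (h zero))) (List.map f gs) ⟩
  ∑ (List.map f (g (h zero))) ℙ.+ ∑ (List.map f gs)
    ≡⟨ cong (∑ (List.map f (g (h zero))) ℙ.+_) (∑-concatMap-tabulate f g (h ∘ suc)) ⟩
  ∑ (List.map f (g (h zero))) ℙ.+ sum (λ i → ∑ (List.map f (g (h (suc i)))))
    ∎
  where gs = concatMap g (tabulate (h ∘ suc))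

∑ᵥ : (t : Tree) → Vector t → 𝔽₂
∑ᵥ t f = ∑ (List.map f (vertices t))

∑ᵥ-cong : {f g : Vector t} → f ≗ g → ∑ᵥ t f ≡ ∑ᵥ t g
∑ᵥ-cong {t} f≗g = cong ∑ (List.map-cong f≗g (vertices t))

∑ᵥ-zero : {f : Vector t} → f ≗ 𝟎 → ∑ᵥ t f ≡ 0ℙ
∑ᵥ-zero {t} f≗0 = ∑-map-zero f≗0 (vertices t)

∑ᵥ-node : {ts : Fin k → Tree} (f : Vector (node k ts)) →
          ∑ᵥ (node k ts) f ≡ f root ℙ.+ sum (λ i → ∑ᵥ (ts i) (f ∘ child i))
∑ᵥ-node {k} {ts} f = cong (f root ℙ.+_) (begin
  ∑ (List.map f (concatMap below (tabulate id)))
    ≡⟨ ∑-concatMap-tabulate f below id ⟩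
  sum (λ i → ∑ (List.map f (below i)))
    ≡⟨ sum-cong-≗ (λ i → cong ∑ (sym (List.map-∘ (vertices (ts i))))) ⟩
  sum (λ i → ∑ᵥ (ts i) (f ∘ child i))
    ∎)
  where
  below : Fin k → List (Vertex (node k ts))
  below i = List.map (child i) (vertices (ts i))

∑ᵥ-root : (x : Vector t) → ∑ᵥ t (λ v → e root v ℙ.* x v) ≡ x root
∑ᵥ-root {node k ts} x = begin
  ∑ᵥ (node k ts) (λ v → e root v ℙ.* x v)
    ≡⟨ ∑ᵥ-node (λ v → e root v ℙ.* x v) ⟩
  x root ℙ.+ sum (λ i → ∑ᵥ (ts i) 𝟎)
    ≡⟨ cong (x root ℙ.+_) (sum-zero _ (λ i → ∑ᵥ-zero {ts i} (λ _ → refl))) ⟩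
  x root ℙ.+ 0ℙ
    ≡⟨ ℙ.+-identityʳ (x root) ⟩
  x root ∎

-- The matrix A(T) + D_ε in terms of the subtrees of the root

parent-nothing : (v : Vertex t) → parent v ≡ nothing → root ≡ v
parent-nothing root _ = refl

Adjacent : Vertex t → Vertex t → Set
Adjacent u v = parent u ≡ just v ⊎ parent v ≡ just u

adjacent? : (u v : Vertex t) → Dec (Adjacent u v)
adjacent? u v = Maybe.≡-dec _≟ᵥ_ (parent u) (just v) ⊎-dec Maybe.≡-dec _≟ᵥ_ (parent v) (just u)

module _ {ts : Fin k → Tree} where

  private
    t′ : Tree
    t′ = node k ts

  parent-is-root : (i : Fin k) (v : Vertex (ts i)) →
                   parent {t′} (child i v) ≡ just root ⇔ root ≡ v
  parent-is-root i v = mk⇔ (parent-nothing v ∘ lemma (parent v)) λ { refl → refl }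
    where
    -- `parent v` is stuck for a variable `v`, so it is replaced by an arbitrary `p`; for
    -- `p = just w` the left side is a `child` and cannot be the root.
    lemma : ∀ p → just (Maybe.maybe′ (child {k} {ts} i) root p) ≡ just root → p ≡ nothing
    lemma nothing _ = refl

  parent-sibling : {i : Fin k} (u v : Vertex (ts i)) →
                   parent {t′} (child i u) ≡ just (child i v) ⇔ parent u ≡ just v
  parent-sibling {i} u v = mk⇔ (lemma (parent u)) (cong (just ∘ Maybe.maybe′ (child i) root))
    where
    lemma : ∀ p → just (Maybe.maybe′ (child {k} {ts} i) root p) ≡ just (child i v) → p ≡ just v
    lemma (just w) refl = refl

  parent-same-child : {i j : Fin k} (u : Vertex (ts i)) (v : Vertex (ts j)) →
                      parent {t′} (child i u) ≡ just (child j v) → i ≡ j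
  parent-same-child {i} {j} u v = lemma (parent u)
    where
    lemma : ∀ p → just (Maybe.maybe′ (child {k} {ts} i) root p) ≡ just (child j v) → i ≡ j
    lemma (just w) refl = refl

  child-≟ : {i : Fin k} (u v : Vertex (ts i)) → ⟦ child {k} {ts} i u ≟ᵥ child i v ⟧ ≡ ⟦ u ≟ᵥ v ⟧
  child-≟ {i} u v =
    ⟦⟧-cong (mk⇔ child-injectiveʳ (cong (child i))) (child {k} {ts} i u ≟ᵥ child i v) (u ≟ᵥ v)

  adjacency-root-child : ∀ i v → adjacency t′ root (child i v) ≡ e root v
  adjacency-root-child i v = ⟦⟧-cong
    (mk⇔ [ (λ ()) , to (parent-is-root i v) ]′
         (inj₂ ∘ from (parent-is-root i v)))
    (adjacent? {t′} root (child i v)) (root ≟ᵥ v)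

  adjacency-child-root : ∀ i v → adjacency t′ (child i v) root ≡ e root v
  adjacency-child-root i v = ⟦⟧-cong
    (mk⇔ [ to (parent-is-root i v) , (λ ()) ]′
         (inj₁ ∘ from (parent-is-root i v)))
    (adjacent? {t′} (child i v) root) (root ≟ᵥ v)

  adjacency-sibling : ∀ i u v → adjacency t′ (child i u) (child i v) ≡ adjacency (ts i) u v
  adjacency-sibling i u v = ⟦⟧-cong
    (mk⇔ (Sum.map (to (parent-sibling u v)) (to (parent-sibling v u)))
         (Sum.map (from (parent-sibling u v)) (from (parent-sibling v u))))
    (adjacent? {t′} (child i u) (child i v)) (adjacent? u v)

  adjacency-distinct : ∀ {i j} → i ≢ j → ∀ u v → adjacency t′ (child i u) (child j v) ≡ 0ℙ
  adjacency-distinct i≢j u v = ⟦⟧-false (adjacent? {t′} (child _ u) (child _ v))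
    [ i≢j ∘ parent-same-child u v , i≢j ∘ sym ∘ parent-same-child v u ]′

  M-root : (ε : Labeling t′) (x : Vector t′) →
           (M t′ ε *ᵥ x) root ≡ sum (λ i → x (child i root)) ℙ.+ (ε root ℙ.* x root)
  M-root ε x = begin
    ∑ᵥ t′ row
      ≡⟨ ∑ᵥ-node row ⟩
    (ε root ℙ.* x root) ℙ.+ sum (λ i → ∑ᵥ (ts i) (row ∘ child i))
      ≡⟨ cong ((ε root ℙ.* x root) ℙ.+_) (sum-cong-≗ below) ⟩
    (ε root ℙ.* x root) ℙ.+ sum (λ i → x (child i root))
      ≡⟨ ℙ.+-comm (ε root ℙ.* x root) _ ⟩
    sum (λ i → x (child i root)) ℙ.+ (ε root ℙ.* x root) ∎
    where
    row : Vector t′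
    row v = M t′ ε root v ℙ.* x v

    below : ∀ i → ∑ᵥ (ts i) (row ∘ child i) ≡ x (child i root)
    below i = begin
      ∑ᵥ (ts i) (row ∘ child i)
        ≡⟨ ∑ᵥ-cong {ts i} (λ v → cong (ℙ._* x (child i v))
             (trans (ℙ.+-identityʳ _) (adjacency-root-child i v))) ⟩
      ∑ᵥ (ts i) (λ v → e root v ℙ.* x (child i v))
        ≡⟨ ∑ᵥ-root (x ∘ child i) ⟩
      x (child i root) ∎

  -- The row splits by columns: the column of the root is nonzero only if `u` is the root of its
  -- subtree, the block of child `i` is the matrix of that subtree, and the blocks of the other
  -- children are zero.
  M-child : (ε : Labeling t′) (x : Vector t′) (i : Fin k) (u : Vertex (ts i)) →
            (M t′ ε *ᵥ x) (child i u) ≡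
            (M (ts i) (ε ∘ child i) *ᵥ (x ∘ child i)) u ℙ.+ (x root ℙ.* e root u)
  M-child ε x i u = begin
    ∑ᵥ t′ row
      ≡⟨ ∑ᵥ-node row ⟩
    row root ℙ.+ sum (λ j → ∑ᵥ (ts j) (row ∘ child j))
      ≡⟨ cong₂ ℙ._+_ at-root (sum-cong-≗ below) ⟩
    (x root ℙ.* e root u) ℙ.+ sum (λ j → Mx ℙ.* ⟦ j Fin.≟ i ⟧)
      ≡⟨ cong ((x root ℙ.* e root u) ℙ.+_) (sum-δ (λ _ → Mx) i) ⟩
    (x root ℙ.* e root u) ℙ.+ Mx
      ≡⟨ ℙ.+-comm (x root ℙ.* e root u) Mx ⟩
    Mx ℙ.+ (x root ℙ.* e root u) ∎
    where
    row : Vector t′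
    row v = M t′ ε (child i u) v ℙ.* x v

    Mx : 𝔽₂
    Mx = (M (ts i) (ε ∘ child i) *ᵥ (x ∘ child i)) u

    at-root : row root ≡ x root ℙ.* e root u
    at-root = trans
      (cong (ℙ._* x root) (trans (ℙ.+-identityʳ _) (adjacency-child-root i u)))
      (ℙ.*-comm (e root u) (x root))

    below : ∀ j → ∑ᵥ (ts j) (row ∘ child j) ≡ Mx ℙ.* ⟦ j Fin.≟ i ⟧
    below j with j Fin.≟ i
    ... | yes refl = trans
      (∑ᵥ-cong {ts i} (λ v → cong (ℙ._* x (child i v))
        (cong₂ ℙ._+_ (adjacency-sibling i u v) (cong (ℙ._* ε (child i u)) (child-≟ u v)))))
      (sym (ℙ.*-identityʳ Mx))
    ... | no j≢i = trans
      (∑ᵥ-zero {ts j} (λ v → cong (ℙ._* x (child j v))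
        (cong₂ ℙ._+_ (adjacency-distinct (j≢i ∘ sym) u v)
          (cong (ℙ._* ε (child i u))
            (⟦⟧-false (child i u ≟ᵥ child j v) λ { refl → j≢i refl })))))
      (sym (ℙ.*-zeroʳ Mx))

-- Subspaces and dimension

record IsSubspace (U : Pred (Vector t) 0ℓ) : Set where
  field
    𝟎-closed : U 𝟎
    ⊕-closed : ∀ {x y} → U x → U y → U (x ⊕ y)

  ·-closed : ∀ α {x} → U x → U (α · x)
  ·-closed 0ℙ _ = 𝟎-closed
  ·-closed 1ℙ u = u

  linComb-closed : (c : Fin n → 𝔽₂) (b : Fin n → Vector t) → (∀ i → U (b i)) → U (linComb c b)
  linComb-closed {zero}  c b b∈U = 𝟎-closed
  linComb-closed {suc n} c b b∈U =
    ⊕-closed (·-closed (c zero) (b∈U zero)) (linComb-closed (c ∘ suc) (b ∘ suc) (b∈U ∘ suc))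

dimension-≐ : {U W : Pred (Vector t) 0ℓ} → U ≐ W → HasDimension U n → HasDimension W n
dimension-≐ (U⊆W , W⊆U) (b , isBasis) = b , record
  { belongs = λ i → U⊆W (belongs i)
  ; independent = independent
  ; spans = λ x x∈W → spans x (W⊆U x∈W)
  }
  where open IsBasis isBasis

linComb-zero : (c : Fin n → 𝔽₂) (b : Fin n → Vector t) → (∀ i → c i ≡ 0ℙ) → linComb c b ≗ 𝟎
linComb-zero c b c≡0 v = sum-zero _ (λ i → cong (ℙ._* b i v) (c≡0 i))

Vanishing : Pred (Vector t) 0ℓ → (Fin n → Vertex t) → Pred (Vector t) 0ℓ
Vanishing W p x = W x × (∀ j → x (p j) ≡ 0ℙ)

-- The vectors v i are dual to evaluation at the vertices p j, so they span a complement of the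
-- subspace of W that vanishes at these vertices.
adjoin : {W : Pred (Vector t) 0ℓ} → IsSubspace W → (p : Fin n → Vertex t) →
         HasDimension (Vanishing W p) m →
         (v : Fin n → Vector t) → (∀ i → W (v i)) → (∀ i j → v i (p j) ≡ ⟦ i Fin.≟ j ⟧) →
         HasDimension W (m ℕ.+ n)
adjoin {t} {n} {m} {W} isSubspace p (b , isBasis) v v∈W dual = b Vec.++ v , record
  { belongs = belongs′
  ; independent = independent′
  ; spans = spans′
  }
  where
  open IsSubspace isSubspace
  open IsBasis isBasis

  split : (c : Fin (m ℕ.+ n) → 𝔽₂) →
          linComb c (b Vec.++ v) ≗ linComb (λ i → c (i ↑ˡ n)) b ⊕ linComb (λ j → c (m ↑ʳ j)) v
  split c u = trans (sum-++ {m} _) (cong₂ ℙ._+_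
    (sum-cong-≗ (λ i → cong (λ y → c (i ↑ˡ n) ℙ.* y u) (Vec.lookup-++ˡ b v i)))
    (sum-cong-≗ (λ j → cong (λ y → c (m ↑ʳ j) ℙ.* y u) (Vec.lookup-++ʳ b v j))))

  coordinate : ∀ c j → linComb c v (p j) ≡ c j
  coordinate c j = trans (sum-cong-≗ (λ i → cong (c i ℙ.*_) (dual i j))) (sum-δ c j)

  belongs′ : ∀ i → W ((b Vec.++ v) i)
  belongs′ i with Fin.splitAt m i
  ... | inj₁ i′ = proj₁ (belongs i′)
  ... | inj₂ j  = v∈W j

  independent′ : ∀ c → linComb c (b Vec.++ v) ≗ 𝟎 → ∀ i → c i ≡ 0ℙ
  independent′ c c≗0 i =
    subst (λ i → c i ≡ 0ℙ) (Fin.join-splitAt m n i) (cases (Fin.splitAt m i))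
    where
    -- Evaluation at `p j` kills every `b i` and singles out the coefficient of `v j`. Once these
    -- coefficients vanish, the independence of `b` settles the others.
    on-v : ∀ j → c (m ↑ʳ j) ≡ 0ℙ
    on-v j = begin
      c (m ↑ʳ j)
        ≡⟨ coordinate (λ j → c (m ↑ʳ j)) j ⟨
      linComb (λ j → c (m ↑ʳ j)) v (p j)
        ≡⟨ cong (ℙ._+ linComb (λ j → c (m ↑ʳ j)) v (p j))
             (sum-zero _ (λ i → trans (cong (c (i ↑ˡ n) ℙ.*_) (proj₂ (belongs i) j))
                                      (ℙ.*-zeroʳ (c (i ↑ˡ n))))) ⟨
      linComb (λ i → c (i ↑ˡ n)) b (p j) ℙ.+ linComb (λ j → c (m ↑ʳ j)) v (p j)
        ≡⟨ split c (p j) ⟨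
      linComb c (b Vec.++ v) (p j)
        ≡⟨ c≗0 (p j) ⟩
      0ℙ ∎

    on-b : ∀ i → c (i ↑ˡ n) ≡ 0ℙ
    on-b = independent _ λ u → begin
      linComb (λ i → c (i ↑ˡ n)) b u
        ≡⟨ ℙ.+-identityʳ _ ⟨
      linComb (λ i → c (i ↑ˡ n)) b u ℙ.+ 0ℙ
        ≡⟨ cong (linComb (λ i → c (i ↑ˡ n)) b u ℙ.+_) (linComb-zero _ v on-v u) ⟨
      linComb (λ i → c (i ↑ˡ n)) b u ℙ.+ linComb (λ j → c (m ↑ʳ j)) v u
        ≡⟨ split c u ⟨
      linComb c (b Vec.++ v) u
        ≡⟨ c≗0 u ⟩
      0ℙ ∎

    cases : ∀ s → c (Fin.join m n s) ≡ 0ℙ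
    cases (inj₁ i) = on-b i
    cases (inj₂ j) = on-v j

  spans′ : ∀ x → W x → ∃[ c ] linComb c (b Vec.++ v) ≗ x
  spans′ x x∈W = cᵇ Vec.++ cᵛ , λ u → begin
    linComb (cᵇ Vec.++ cᵛ) (b Vec.++ v) u
      ≡⟨ split (cᵇ Vec.++ cᵛ) u ⟩
    linComb (λ i → (cᵇ Vec.++ cᵛ) (i ↑ˡ n)) b u ℙ.+ linComb (λ j → (cᵇ Vec.++ cᵛ) (m ↑ʳ j)) v u
      ≡⟨ cong₂ ℙ._+_ (sum-cong-≗ (λ i → cong (ℙ._* b i u) (Vec.lookup-++ˡ cᵇ cᵛ i)))
                     (sum-cong-≗ (λ j → cong (ℙ._* v j u) (Vec.lookup-++ʳ cᵇ cᵛ j))) ⟩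
    linComb cᵇ b u ℙ.+ linComb cᵛ v u
      ≡⟨ cong (ℙ._+ linComb cᵛ v u) (proj₂ inU u) ⟩
    (x u ℙ.+ linComb cᵛ v u) ℙ.+ linComb cᵛ v u
      ≡⟨ x+y+y≡x (x u) (linComb cᵛ v u) ⟩
    x u ∎
    where
    cᵛ : Fin n → 𝔽₂
    cᵛ j = x (p j)

    -- Over 𝔽₂ adding is subtracting: removing the combination whose coefficients are the values of
    -- `x` at the `p j` leaves a vector of `W` that vanishes there.
    inU : ∃[ c ] linComb c b ≗ x ⊕ linComb cᵛ v
    inU = spans (x ⊕ linComb cᵛ v)
      ( ⊕-closed x∈W (linComb-closed cᵛ v v∈W)
      , λ j → trans (cong (x (p j) ℙ.+_) (coordinate cᵛ j)) (ℙ.p+p≡0ℙ (x (p j))))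

    cᵇ : Fin m → 𝔽₂
    cᵇ = proj₁ inU

embed : Fin k → Vector t → Vector (node k (λ _ → t))
embed i x root        = 0ℙ
embed i x (child j v) = ⟦ i Fin.≟ j ⟧ ℙ.* x v

-- The direct sum of `k` copies of `U`, realised among the vectors on the larger tree.
Copies : (k : ℕ) → Pred (Vector t) 0ℓ → Pred (Vector (node k (λ _ → t))) 0ℓ
Copies k U x = x root ≡ 0ℙ × (∀ i → U (x ∘ child i))

copies-dimension : ∀ k {U : Pred (Vector t) 0ℓ} → IsSubspace U → HasDimension U n →
                   HasDimension (Copies k U) (k ℕ.* n)
copies-dimension {t} {n} k {U} isSubspace (b , isBasis) = b′ , record
  { belongs = λ i → refl , λ j → ·-closed _ (belongs _)
  ; independent = independent′
  ; spans = spans′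
  }
  where
  open IsSubspace isSubspace
  open IsBasis isBasis

  b′ : Fin (k ℕ.* n) → Vector (node k (λ _ → t))
  b′ = uncurry (λ i j → embed i (b j)) ∘ remQuot n

  -- Only the block of coefficients belonging to child `i` survives there, so independence and
  -- spanning reduce to those of `b`, one child at a time.
  on-child : ∀ c i v → linComb c b′ (child i v) ≡ linComb (λ j → c (combine i j)) b v
  on-child c i v = begin
    linComb c b′ (child i v)
      ≡⟨ sum-combine {k} {n} (λ q → c q ℙ.* b′ q (child i v)) ⟩
    sum (λ (i′ : Fin k) → sum (λ (j : Fin n) → c (combine i′ j) ℙ.* b′ (combine i′ j) (child i v)))
      ≡⟨ sum-cong-≗ (λ i′ → trans (sum-cong-≗ (λ j → term i′ j))
                                  (sym (*-distribʳ-sum ⟦ i′ Fin.≟ i ⟧ (λ j → c (combine i′ j) ℙ.* b j v)))) ⟩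
    sum (λ i′ → linComb (λ j → c (combine i′ j)) b v ℙ.* ⟦ i′ Fin.≟ i ⟧)
      ≡⟨ sum-δ (λ i′ → linComb (λ j → c (combine i′ j)) b v) i ⟩
    linComb (λ j → c (combine i j)) b v ∎
    where
    term : ∀ i′ j → c (combine i′ j) ℙ.* b′ (combine i′ j) (child i v) ≡
                    (c (combine i′ j) ℙ.* b j v) ℙ.* ⟦ i′ Fin.≟ i ⟧
    term i′ j = begin
      c (combine i′ j) ℙ.* b′ (combine i′ j) (child i v)
        ≡⟨ cong (λ q → c (combine i′ j) ℙ.* uncurry (λ i j → embed i (b j)) q (child i v))
             (Fin.remQuot-combine i′ j) ⟩
      c (combine i′ j) ℙ.* (⟦ i′ Fin.≟ i ⟧ ℙ.* b j v)
        ≡⟨ cong (c (combine i′ j) ℙ.*_) (ℙ.*-comm ⟦ i′ Fin.≟ i ⟧ (b j v)) ⟩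
      c (combine i′ j) ℙ.* (b j v ℙ.* ⟦ i′ Fin.≟ i ⟧)
        ≡⟨ ℙ.*-assoc (c (combine i′ j)) (b j v) ⟦ i′ Fin.≟ i ⟧ ⟨
      (c (combine i′ j) ℙ.* b j v) ℙ.* ⟦ i′ Fin.≟ i ⟧ ∎

  independent′ : ∀ c → linComb c b′ ≗ 𝟎 → ∀ q → c q ≡ 0ℙ
  independent′ c c≗0 q with i , j , refl ← Fin.combine-surjective {k} {n} q =
    independent (λ j → c (combine i j))
      (λ v → trans (sym (on-child c i v)) (c≗0 (child i v))) j

  spans′ : ∀ x → Copies k U x → ∃[ c ] linComb c b′ ≗ x
  spans′ x (x-root , x∈U) = c , λ
    { root        → trans (sum-zero _ (λ q → ℙ.*-zeroʳ (c q))) (sym x-root)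
    ; (child i v) → begin
        linComb c b′ (child i v)             ≡⟨ on-child c i v ⟩
        linComb (λ j → c (combine i j)) b v  ≡⟨ sum-cong-≗ (λ j → cong (λ q → uncurry c₂ q ℙ.* b j v)
                                                  (Fin.remQuot-combine i j)) ⟩
        linComb (c₂ i) b v                   ≡⟨ proj₂ (spans (x ∘ child i) (x∈U i)) v ⟩
        x (child i v)                        ∎
    }
    where
    c₂ : Fin k → Fin n → 𝔽₂
    c₂ i = proj₁ (spans (x ∘ child i) (x∈U i))

    c : Fin (k ℕ.* n) → 𝔽₂
    c = uncurry c₂ ∘ remQuot n

-- Enumeration of all vectors

∈-vertices : (v : Vertex t) → v ∈ vertices t
∈-vertices {node k ts} root        = here refl
∈-vertices {node k ts} (child i v) = there
  (List.∈-concatMap⁺ (λ i → List.map (child i) (vertices (ts i)))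
    (lose (List.∈-allFin i) (List.∈-map⁺ (child i) (∈-vertices v))))

-- If the choice made for `vs` already has the right value at `v`, it is kept. Otherwise adding
-- `e v` flips the value at `v` and no other.
subset-sums-agree : (x : Vector t) (vs : List (Vertex t)) →
  ∃[ y ] y ∈ List.foldr (λ v xs → xs ++ List.map (e v ⊕_) xs) (𝟎 ∷ []) vs ×
         (∀ {u} → u ∈ vs → y u ≡ x u)
subset-sums-agree x [] = 𝟎 , here refl , λ ()
subset-sums-agree {t} x (v ∷ vs)
  with y , y∈ , agree ← subset-sums-agree x vs | y v ℙ.≟ x v
... | yes eq = y , List.∈-++⁺ˡ y∈ , λ { (here refl) → eq ; (there u∈) → agree u∈ }
... | no neq = e v ⊕ y , List.∈-++⁺ʳ _ (List.∈-map⁺ (e v ⊕_) y∈) , agree′ _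
  where
  flip : ∀ α β → α ≢ β → 1ℙ ℙ.+ α ≡ β
  flip 0ℙ 0ℙ α≢β = contradiction refl α≢β
  flip 0ℙ 1ℙ _   = refl
  flip 1ℙ 0ℙ _   = refl
  flip 1ℙ 1ℙ α≢β = contradiction refl α≢β

  agree′ : ∀ u → u ∈ v ∷ vs → (e v ⊕ y) u ≡ x u
  agree′ u u∈ with v ≟ᵥ u | u∈
  ... | yes refl | _         = flip (y v) (x v) neq
  ... | no v≢u   | here refl = contradiction refl v≢u
  ... | no v≢u   | there u∈′ = agree u∈′

vectors-complete : (x : Vector t) → ∃[ y ] y ∈ vectors t × y ≗ x
vectors-complete {t} x with y , y∈ , agree ← subset-sums-agree x (vertices t) =
  y , y∈ , λ v → agree (∈-vertices v)

*ᵥ-cong : (A : Matrix t) {x y : Vector t} → x ≗ y → A *ᵥ x ≗ A *ᵥ y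
*ᵥ-cong {t} A x≗y u = ∑ᵥ-cong {t} (λ v → cong (A u v ℙ.*_) (x≗y v))

L⇔solvable : (ε : Labeling t) (α β : 𝔽₂) → L t ε (α , β) ⇔ (∃[ x ] IsSolution t ε α β x)
L⇔solvable {t} ε α β = mk⇔ solution nonempty
  where
  solution : L t ε (α , β) → ∃[ x ] IsSolution t ε α β x
  solution N≢0 with List.filter (isSolution? t ε α β) (vectors t) in eq
  ... | []     = contradiction refl N≢0
  ... | x ∷ xs = x , proj₂ (List.∈-filter⁻ (isSolution? t ε α β) {xs = vectors t}
                             (subst (x ∈_) (sym eq) (here refl)))

  nonempty : ∃[ x ] IsSolution t ε α β x → L t ε (α , β)
  -- The enumeration contains `x` only up to pointwise equality, so it is the representative `y`
  -- that passes the filter.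
  nonempty (x , Mx≗ , x-root) N≡0 with y , y∈ , y≗x ← vectors-complete x
    with List.filter (isSolution? t ε α β) (vectors t)
       | List.∈-filter⁺ (isSolution? t ε α β) y∈
           ((λ v → trans (*ᵥ-cong (M t ε) y≗x v) (Mx≗ v)) , trans (y≗x root) x-root)
  ... | _ ∷ _ | _ = contradiction N≡0 λ ()

-- Boundary behaviour of solutions

-- The inhomogeneous (μ = 1) and the homogeneous (μ = 0) systems are treated together.
Solves : Labeling t → 𝔽₂ → 𝔽₂ → 𝔽₂ → Pred (Vector t) 0ℓ
Solves {t} ε μ α β x = (M t ε *ᵥ x ≗ μ · ε ⊕ α · e root) × x root ≡ β

-- The root row solved for `α`; `s` stands for the sum of the root values of the children and `a`
-- for the label of the root.
root-equation : ∀ a μ α β s →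
  s ℙ.+ (a ℙ.* β) ≡ (μ ℙ.* a) ℙ.+ (α ℙ.* 1ℙ) ⇔ α ≡ s ℙ.+ (a ℙ.* (μ ℙ.+ β))
root-equation = toWitness
  {a? = ∀ℙ? λ a → ∀ℙ? λ μ → ∀ℙ? λ α → ∀ℙ? λ β → ∀ℙ? λ s → _ ℙ.≟ _ ⇔? _ ℙ.≟ _} _

-- In a row below the root the `α` term has coefficient zero, and the contribution `b` of the root
-- moves to the right-hand side.
child-equation : ∀ α b c y → y ℙ.+ b ≡ c ℙ.+ (α ℙ.* 0ℙ) ⇔ y ≡ c ℙ.+ b
child-equation = toWitness {a? = ∀ℙ? λ α → ∀ℙ? λ b → ∀ℙ? λ c → ∀ℙ? λ y → _ ℙ.≟ _ ⇔? _ ℙ.≟ _} _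

-- The value at the root enters the system of each child exactly as that child's parameter `α`. Once
-- it is fixed the children are independent, and only the root row couples them.
solves-node : {ts : Fin k → Tree} (ε : Labeling (node k ts)) (μ α : 𝔽₂) (x : Vector (node k ts)) →
  Solves ε μ α (x root) x ⇔
  ((∀ i → Solves (ε ∘ child i) μ (x root) (x (child i root)) (x ∘ child i)) ×
   α ≡ sum (λ i → x (child i root)) ℙ.+ (ε root ℙ.* (μ ℙ.+ x root)))
solves-node {ts = ts} ε μ α x = mk⇔
  (λ { (Mx≗ , _) →
      (λ i → (λ v → to (at-child i v) (trans (sym (M-child ε x i v)) (Mx≗ (child i v)))) , refl)
    , to at-root (trans (sym (M-root ε x)) (Mx≗ root)) })
  (λ { (below , eq) →
      (λ { root        → trans (M-root ε x) (from at-root eq)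
         ; (child i v) → trans (M-child ε x i v) (from (at-child i v) (proj₁ (below i) v)) })
    , refl })
  where
  at-root = root-equation (ε root) μ α (x root) (sum (λ i → x (child i root)))
  at-child = λ i v → child-equation α (x root ℙ.* e root v) (μ ℙ.* ε (child i v))
                       ((M (ts i) (ε ∘ child i) *ᵥ (x ∘ child i)) v)

-- Solvable boundary values form a line

-- The direction of an affine line in the (α , β)-plane, named by the linear form that is constant
-- on the line.
data Direction : Set where
  α-const β-const sum-const : Direction

form : Direction → 𝔽₂ → 𝔽₂ → 𝔽₂
form α-const   α β = α
form β-const   α β = β
form sum-const α β = α ℙ.+ β

Line : Set
Line = Direction × 𝔽₂

_On_ : 𝔽₂ × 𝔽₂ × 𝔽₂ → Line → Set
(μ , α , β) On (dir , c) = form dir α β ≡ μ ℙ.* c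

-- The direction of the lines `α = s β + const`, indexed by the slope `s`.
graph : 𝔽₂ → Direction
graph 0ℙ = α-const
graph 1ℙ = sum-const

-- δ is the parity of the number of children and s the label of their parent.
step : 𝔽₂ → 𝔽₂ → Line → Line
step δ s (α-const   , c) = β-const , c
step δ s (β-const   , c) = graph s , (δ ℙ.* c) ℙ.+ s
step δ s (sum-const , c) = graph (δ ℙ.+ s) , (δ ℙ.* c) ℙ.+ s

leaf-equation : ∀ s μ α β → α ≡ s ℙ.* (μ ℙ.+ β) ⇔ form (graph s) α β ≡ μ ℙ.* s
leaf-equation = toWitness {a? = ∀ℙ? λ s → ∀ℙ? λ μ → ∀ℙ? λ α → ∀ℙ? λ β → _ ℙ.≟ _ ⇔? _ ℙ.≟ _} _

-- Here every child has root value `μ c`, so the children contribute `δ (μ c)` and the slope is `s`.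
β-const-equation : ∀ δ c s μ α β →
  α ≡ (δ ℙ.* (μ ℙ.* c)) ℙ.+ (s ℙ.* (μ ℙ.+ β)) ⇔ form (graph s) α β ≡ μ ℙ.* ((δ ℙ.* c) ℙ.+ s)
β-const-equation = toWitness
  {a? = ∀ℙ? λ δ → ∀ℙ? λ c → ∀ℙ? λ s → ∀ℙ? λ μ → ∀ℙ? λ α → ∀ℙ? λ β → _ ℙ.≟ _ ⇔? _ ℙ.≟ _} _

-- Here every child has root value `μ c + β`, so the children add `δ` to the slope.
sum-const-equation : ∀ δ c s μ α β →
  α ≡ (δ ℙ.* ((μ ℙ.* c) ℙ.+ β)) ℙ.+ (s ℙ.* (μ ℙ.+ β)) ⇔
  form (graph (δ ℙ.+ s)) α β ≡ μ ℙ.* ((δ ℙ.* c) ℙ.+ s)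
sum-const-equation = toWitness
  {a? = ∀ℙ? λ δ → ∀ℙ? λ c → ∀ℙ? λ s → ∀ℙ? λ μ → ∀ℙ? λ α → ∀ℙ? λ β → _ ℙ.≟ _ ⇔? _ ℙ.≟ _} _

solve-sum : ∀ x y z → x ℙ.+ y ≡ z ⇔ y ≡ z ℙ.+ x
solve-sum = toWitness {a? = ∀ℙ? λ x → ∀ℙ? λ y → ∀ℙ? λ z → _ ℙ.≟ _ ⇔? _ ℙ.≟ _} _

-- Written as a sum of ones so that `sum-constant` produces it directly.
parityOf : ℕ → 𝔽₂
parityOf n = sum {n} (λ _ → 1ℙ)

-- Each child sees the parent's `β` as its `α`. If the children's line fixes `α`, it restricts only
-- the parent's `β`, and the free root values of the children, at least one in number, reach every
-- sum. In the other two cases `β` determines all these values, hence `α`.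
step-correct : ∀ n s line μ α β →
  (∃[ βs ] (∀ (i : Fin (suc n)) → (μ , β , βs i) On line) × α ≡ sum βs ℙ.+ (s ℙ.* (μ ℙ.+ β))) ⇔
  (μ , α , β) On step (parityOf (suc n)) s line
step-correct n s (α-const , c) μ α β = mk⇔
  (λ { (_ , on , _) → on zero })
  -- The first child carries the whole sum that the root equation demands.
  (λ on → (λ { zero → α ℙ.+ (s ℙ.* (μ ℙ.+ β)) ; (suc _) → 0ℙ }) , (λ _ → on) , sym (begin
    ((α ℙ.+ r) ℙ.+ sum {n} (λ _ → 0ℙ)) ℙ.+ r
      ≡⟨ cong (λ z → ((α ℙ.+ r) ℙ.+ z) ℙ.+ r) (sum-replicate-zero n) ⟩
    ((α ℙ.+ r) ℙ.+ 0ℙ) ℙ.+ r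
      ≡⟨ cong (ℙ._+ r) (ℙ.+-identityʳ (α ℙ.+ r)) ⟩
    (α ℙ.+ r) ℙ.+ r
      ≡⟨ x+y+y≡x α r ⟩
    α ∎))
  where r = s ℙ.* (μ ℙ.+ β)
step-correct n s (β-const , c) μ α β = mk⇔
  (λ { (βs , on , eq) → to equation (trans eq (cong (ℙ._+ r) (trans (sum-cong-≗ on) const-sum))) })
  (λ on → (λ _ → μ ℙ.* c) , (λ _ → refl) , trans (from equation on) (cong (ℙ._+ r) (sym const-sum)))
  where
  r = s ℙ.* (μ ℙ.+ β)
  equation = β-const-equation (parityOf (suc n)) c s μ α β
  const-sum = sum-constant (suc n) (μ ℙ.* c)
step-correct n s (sum-const , c) μ α β = mk⇔
  (λ { (βs , on , eq) → to equation (trans eq (cong (ℙ._+ r)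
         (trans (sum-cong-≗ (λ i → to (solve-sum β (βs i) (μ ℙ.* c)) (on i))) const-sum))) })
  (λ on → (λ _ → (μ ℙ.* c) ℙ.+ β) , (λ _ → from (solve-sum β _ (μ ℙ.* c)) refl) ,
          trans (from equation on) (cong (ℙ._+ r) (sym const-sum)))
  where
  r = s ℙ.* (μ ℙ.+ β)
  equation = sum-const-equation (parityOf (suc n)) c s μ α β
  const-sum = sum-constant (suc n) ((μ ℙ.* c) ℙ.+ β)

height-complete : ∀ n h → height (complete (suc n) h) ≡ h
height-complete n zero    = refl
height-complete n (suc h) = trans (constant-max n) (cong suc (height-complete n h))
  where
  constant-max : ∀ k {m} → Vec.foldr ℕ._⊔_ 0 {suc k} (λ _ → m) ≡ m
  constant-max zero    {m} = ℕ.⊔-identityʳ m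
  constant-max (suc k) {m} = trans (cong (m ℕ.⊔_) (constant-max k)) (ℕ.⊔-idem m)

-- Finite encoding of the lines, for the pigeonhole argument

encodeLine : Line → Fin 6
encodeLine (dir , c) = combine (encodeDirection dir) (encodeParity c)
  where
  encodeDirection : Direction → Fin 3
  encodeDirection α-const   = zero
  encodeDirection β-const   = suc zero
  encodeDirection sum-const = suc (suc zero)

  encodeParity : 𝔽₂ → Fin 2
  encodeParity 0ℙ = zero
  encodeParity 1ℙ = suc zero

decodeLine : Fin 6 → Line
decodeLine i = decodeDirection (proj₁ (remQuot 2 i)) , decodeParity (proj₂ (remQuot {3} 2 i))
  where
  decodeDirection : Fin 3 → Direction
  decodeDirection zero             = α-const
  decodeDirection (suc zero)       = β-const
  decodeDirection (suc (suc zero)) = sum-const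

  decodeParity : Fin 2 → 𝔽₂
  decodeParity zero       = 0ℙ
  decodeParity (suc zero) = 1ℙ

decode-encode : ∀ l → decodeLine (encodeLine l) ≡ l
decode-encode (α-const   , 0ℙ) = refl
decode-encode (α-const   , 1ℙ) = refl
decode-encode (β-const   , 0ℙ) = refl
decode-encode (β-const   , 1ℙ) = refl
decode-encode (sum-const , 0ℙ) = refl
decode-encode (sum-const , 1ℙ) = refl

encodeLine-injective : ∀ {l l′} → encodeLine l ≡ encodeLine l′ → l ≡ l′
encodeLine-injective {l} {l′} eq =
  trans (sym (decode-encode l)) (trans (cong decodeLine eq) (decode-encode l′))

-- Kernels

*ᵥ-𝟎 : (A : Matrix t) → A *ᵥ 𝟎 ≗ 𝟎
*ᵥ-𝟎 {t} A u = ∑ᵥ-zero {t} (λ v → ℙ.*-zeroʳ (A u v))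

*ᵥ-⊕ : (A : Matrix t) (x y : Vector t) → A *ᵥ (x ⊕ y) ≗ A *ᵥ x ⊕ A *ᵥ y
*ᵥ-⊕ {t} A x y u = trans
  (∑ᵥ-cong {t} (λ v → ℙ.*-distribˡ-+ (A u v) (x v) (y v)))
  (∑-map-+ (λ v → A u v ℙ.* x v) (λ v → A u v ℙ.* y v) (vertices t))

ker-isSubspace : (A : Matrix t) → IsSubspace (ker A)
ker-isSubspace A = record
  { 𝟎-closed = *ᵥ-𝟎 A
  ; ⊕-closed = λ {x} {y} Ax≗𝟎 Ay≗𝟎 v → trans (*ᵥ-⊕ A x y v) (cong₂ ℙ._+_ (Ax≗𝟎 v) (Ay≗𝟎 v))
  }

-- The right-hand side computes to `𝟎`, so this is the space whose dimension for the complete tree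
-- of height h is called z_h above.
RootedKer : Labeling t → Pred (Vector t) 0ℓ
RootedKer ε = Solves ε 0ℙ 0ℙ 0ℙ

rootedKer-isSubspace : (ε : Labeling t) → IsSubspace (RootedKer ε)
rootedKer-isSubspace {t} ε = record
  { 𝟎-closed = 𝟎-closed , refl
  ; ⊕-closed = λ { (Mx≗𝟎 , x-root) (My≗𝟎 , y-root) → ⊕-closed Mx≗𝟎 My≗𝟎 , cong₂ ℙ._+_ x-root y-root }
  }
  where open IsSubspace (ker-isSubspace (M t ε))

ker-vanishing-at-root : (ε : Labeling t) → RootedKer ε ≐ Vanishing {n = 1} (ker (M t ε)) (λ _ → root)
ker-vanishing-at-root ε =
  (λ { (Mx≗𝟎 , x-root) → Mx≗𝟎 , λ _ → x-root }) , (λ { (Mx≗𝟎 , x-root) → Mx≗𝟎 , x-root zero })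

rooted-equation : ∀ a s → 0ℙ ≡ s ℙ.+ (a ℙ.* 0ℙ) ⇔ s ≡ 0ℙ
rooted-equation = toWitness {a? = ∀ℙ? λ a → ∀ℙ? λ s → _ ℙ.≟ _ ⇔? _ ℙ.≟ _} _

-- A zero at the root decouples the children into kernel vectors of their own matrices; the root row
-- leaves one linear condition on their root values.
rootedKer-node : (ε : Labeling (node k (λ _ → t))) {x : Vector (node k (λ _ → t))} →
  RootedKer ε x ⇔
  (x root ≡ 0ℙ × (∀ i → ker (M t (ε ∘ child i)) (x ∘ child i)) × sum (λ i → x (child i root)) ≡ 0ℙ)
rootedKer-node {k} {t} ε {x} = mk⇔ restrict extend
  where
  Children : Set
  Children =
    x root ≡ 0ℙ × (∀ i → ker (M t (ε ∘ child i)) (x ∘ child i)) × sum (λ i → x (child i root)) ≡ 0ℙ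

  restrict : RootedKer ε x → Children
  restrict (Mx≗𝟎 , x-root) with below , eq ← to (solves-node ε 0ℙ 0ℙ x) (Mx≗𝟎 , refl)
    rewrite x-root = refl , proj₁ ∘ below , to (rooted-equation (ε root) _) eq

  extend : Children → RootedKer ε x
  extend (x-root , below , sum≡0) = proj₁ (from (solves-node ε 0ℙ 0ℙ x) children) , x-root
    where
    children : (∀ i → Solves (ε ∘ child i) 0ℙ (x root) (x (child i root)) (x ∘ child i)) ×
               0ℙ ≡ sum (λ i → x (child i root)) ℙ.+ (ε root ℙ.* (0ℙ ℙ.+ x root))
    children rewrite x-root = (λ i → below i , refl) , from (rooted-equation (ε root) _) sum≡0

sum-embed-root : (i : Fin k) (x : Vector t) → sum (λ j → embed i x (child j root)) ≡ x root
sum-embed-root i x = trans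
  (sum-cong-≗ (λ j → trans (cong (ℙ._* x root) (⟦≟⟧-sym i j)) (ℙ.*-comm ⟦ j Fin.≟ i ⟧ (x root))))
  (sum-δ (λ _ → x root) i)

-- Automata driven by an eventually periodic input

shift : {A : Set} {s : ℕ → A} {H q : ℕ} → (∀ h → H ≤ h → s (h ℕ.+ q) ≡ s h) →
        ∀ k h → H ≤ h → s (h ℕ.+ k ℕ.* q) ≡ s h
shift {s = s} periodic zero h _ = cong s (ℕ.+-identityʳ h)
shift {s = s} {H} {q} periodic (suc k) h H≤h = begin
  s (h ℕ.+ (q ℕ.+ k ℕ.* q))  ≡⟨ cong (λ p → s (h ℕ.+ p)) (ℕ.+-comm q (k ℕ.* q)) ⟩
  s (h ℕ.+ (k ℕ.* q ℕ.+ q))  ≡⟨ cong s (ℕ.+-assoc h (k ℕ.* q) q) ⟨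
  s (h ℕ.+ k ℕ.* q ℕ.+ q)    ≡⟨ periodic (h ℕ.+ k ℕ.* q) (ℕ.m≤n⇒m≤n+o (k ℕ.* q) H≤h) ⟩
  s (h ℕ.+ k ℕ.* q)          ≡⟨ shift {s = s} periodic k h H≤h ⟩
  s h                        ∎

-- By pigeonhole, two of the states reached after full periods of the input coincide.
automaton-eventuallyPeriodic : {A S : Set} (encode : S → Fin n) → (∀ {x y} → encode x ≡ encode y → x ≡ y) →
  (next : A → S → S) (input : ℕ → A) (s : ℕ → S) → (∀ h → s (suc h) ≡ next (input (suc h)) (s h)) →
  EventuallyPeriodic _≡_ input → EventuallyPeriodic _≡_ s
automaton-eventuallyPeriodic {n} encode injective next input s s-suc (H , q , 1≤q , periodic)
  with i , j , i<j , eq ← Fin.pigeonhole ℕ.≤-refl (λ (i : Fin (suc n)) → encode (s (H ℕ.+ toℕ i ℕ.* q)))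
  -- The strict inequality gives `j = i + suc k`, so the period `suc k * q` is positive.
  with k , j≡ ← ℕ.m≤n⇒∃[o]m+o≡n i<j =
  H₁ , suc k ℕ.* q , ℕ.*-mono-≤ {1} {suc k} (ℕ.s≤s ℕ.z≤n) 1≤q ,
  λ h H₁≤h → subst (λ h → s (h ℕ.+ suc k ℕ.* q) ≡ s h) (ℕ.m∸n+n≡m H₁≤h) (repeat (h ℕ.∸ H₁))
  where
  H₁ : ℕ
  H₁ = H ℕ.+ toℕ i ℕ.* q

  H₂≡ : H ℕ.+ toℕ j ℕ.* q ≡ H₁ ℕ.+ suc k ℕ.* q
  H₂≡ = trans (cong (λ j → H ℕ.+ j ℕ.* q) (trans (sym j≡) (sym (ℕ.+-suc (toℕ i) k))))
              (lemma H (toℕ i) (suc k) q)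
    where
    lemma : ∀ H i k q → H ℕ.+ (i ℕ.+ k) ℕ.* q ≡ H ℕ.+ i ℕ.* q ℕ.+ k ℕ.* q
    lemma = solve-∀

  -- After the coincidence both runs start in the same state and, `suc k * q` being a multiple of
  -- the input period, read the same input.
  repeat : ∀ m → s (m ℕ.+ H₁ ℕ.+ suc k ℕ.* q) ≡ s (m ℕ.+ H₁)
  repeat zero    = trans (cong s (sym H₂≡)) (sym (injective eq))
  repeat (suc m) = begin
    s (suc (m ℕ.+ H₁ ℕ.+ suc k ℕ.* q))
      ≡⟨ s-suc _ ⟩
    next (input (suc (m ℕ.+ H₁) ℕ.+ suc k ℕ.* q)) (s (m ℕ.+ H₁ ℕ.+ suc k ℕ.* q))
      ≡⟨ cong₂ next (shift {s = input} periodic (suc k) (suc (m ℕ.+ H₁)) H≤) (repeat m) ⟩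
    next (input (suc (m ℕ.+ H₁))) (s (m ℕ.+ H₁))
      ≡⟨ s-suc _ ⟨
    s (suc (m ℕ.+ H₁)) ∎
    where
    H≤ : H ≤ suc (m ℕ.+ H₁)
    H≤ = ℕ.≤-trans (ℕ.m≤m+n H (toℕ i ℕ.* q)) (ℕ.m≤n+m H₁ (suc m))

-- Affine recurrences with periodic inhomogeneity

-- Normalised fractions with variable numerators do not compute. Among unnormalised ones an equation
-- is a cross-multiplied identity of integers, and this lemma transfers it back.
fromℚᵘ-homo-+ : ∀ p q → ℚ.fromℚᵘ (p ℚᵘ.+ q) ≡ ℚ.fromℚᵘ p + ℚ.fromℚᵘ q
fromℚᵘ-homo-+ p q = ℚ.toℚᵘ-injective (ℚᵘ.≃-trans (ℚ.toℚᵘ-fromℚᵘ _) (ℚᵘ.≃-sym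
  (ℚᵘ.≃-trans (ℚ.toℚᵘ-homo-+ (ℚ.fromℚᵘ p) (ℚ.fromℚᵘ q)) (ℚᵘ.+-cong (ℚ.toℚᵘ-fromℚᵘ p) (ℚ.toℚᵘ-fromℚᵘ q)))))

fromℚᵘ-homo-* : ∀ p q → ℚ.fromℚᵘ (p ℚᵘ.* q) ≡ ℚ.fromℚᵘ p * ℚ.fromℚᵘ q
fromℚᵘ-homo-* p q = ℚ.toℚᵘ-injective (ℚᵘ.≃-trans (ℚ.toℚᵘ-fromℚᵘ _) (ℚᵘ.≃-sym
  (ℚᵘ.≃-trans (ℚ.toℚᵘ-homo-* (ℚ.fromℚᵘ p) (ℚ.fromℚᵘ q)) (ℚᵘ.*-cong (ℚ.toℚᵘ-fromℚᵘ p) (ℚ.toℚᵘ-fromℚᵘ q)))))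

fromℕ-homo-+ : ∀ m n → fromℕ (m ℕ.+ n) ≡ fromℕ m + fromℕ n
fromℕ-homo-+ m n = trans
  (ℚ.fromℚᵘ-cong {mkℚᵘ (ℤ.+ (m ℕ.+ n)) 0} {mkℚᵘ (ℤ.+ m) 0 ℚᵘ.+ mkℚᵘ (ℤ.+ n) 0}
    (*≡* (cong (ℤ._* ℤ.+ 1) (sym (cong₂ ℤ._+_ (ℤ.*-identityʳ (ℤ.+ m)) (ℤ.*-identityʳ (ℤ.+ n)))))))
  (fromℚᵘ-homo-+ (mkℚᵘ (ℤ.+ m) 0) (mkℚᵘ (ℤ.+ n) 0))

fromℕ-homo-* : ∀ m n → fromℕ (m ℕ.* n) ≡ fromℕ m * fromℕ n
fromℕ-homo-* m n = trans
  (ℚ.fromℚᵘ-cong {mkℚᵘ (ℤ.+ (m ℕ.* n)) 0} {mkℚᵘ (ℤ.+ m) 0 ℚᵘ.* mkℚᵘ (ℤ.+ n) 0}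
    (*≡* (cong (ℤ._* ℤ.+ 1) (ℤ.pos-* m n))))
  (fromℚᵘ-homo-* (mkℚᵘ (ℤ.+ m) 0) (mkℚᵘ (ℤ.+ n) 0))

fromℕ-inverse : ∀ n → fromℕ (suc n) * (ℤ.+ 1 ℚ./ suc n) ≡ ℚ.1ℚ
fromℕ-inverse n = trans
  (sym (fromℚᵘ-homo-* (mkℚᵘ (ℤ.+ suc n) 0) (mkℚᵘ (ℤ.+ 1) n)))
  (ℚ.fromℚᵘ-cong {mkℚᵘ (ℤ.+ suc n) 0 ℚᵘ.* mkℚᵘ (ℤ.+ 1) n} {ℚᵘ.1ℚᵘ} (*≡* (cong ℤ.+_ (lemma n))))
  where
  lemma : ∀ n → suc n ℕ.* 1 ℕ.* 1 ≡ 1 ℕ.* (1 ℕ.* suc n)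
  lemma = solve-∀

module _ (d : ℕ) (2≤d : 2 ≤ d) (z g : ℕ → ℕ) (z-suc : ∀ h → z (suc h) ≡ d ℕ.* z h ℕ.+ g h) where

  private
    -- What the inhomogeneity accumulates in `k` steps from `h`: the sum of
    -- `d ^ (k - 1 - i) * g (h + i)` over `i < k`.
    defect : ℕ → ℕ → ℕ
    defect zero    h = 0
    defect (suc k) h = d ℕ.* defect k h ℕ.+ g (h ℕ.+ k)

    z-+ : ∀ h k → z (h ℕ.+ k) ≡ d ^ k ℕ.* z h ℕ.+ defect k h
    z-+ h zero    = trans (cong z (ℕ.+-identityʳ h)) (sym (trans (ℕ.+-identityʳ _) (ℕ.*-identityˡ (z h))))
    z-+ h (suc k) = begin
      z (h ℕ.+ suc k)
        ≡⟨ cong z (ℕ.+-suc h k) ⟩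
      z (suc (h ℕ.+ k))
        ≡⟨ z-suc (h ℕ.+ k) ⟩
      d ℕ.* z (h ℕ.+ k) ℕ.+ g (h ℕ.+ k)
        ≡⟨ cong (λ y → d ℕ.* y ℕ.+ g (h ℕ.+ k)) (z-+ h k) ⟩
      d ℕ.* (d ^ k ℕ.* z h ℕ.+ defect k h) ℕ.+ g (h ℕ.+ k)
        ≡⟨ lemma d (d ^ k) (z h) (defect k h) (g (h ℕ.+ k)) ⟩
      d ^ suc k ℕ.* z h ℕ.+ defect (suc k) h ∎
      where
      lemma : ∀ d e y c g → d ℕ.* (e ℕ.* y ℕ.+ c) ℕ.+ g ≡ d ℕ.* e ℕ.* y ℕ.+ (d ℕ.* c ℕ.+ g)
      lemma = solve-∀

    instance
      d≢0 : ℕ.NonZero d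
      d≢0 = ℕ.>-nonZero (ℕ.≤-trans (ℕ.s≤s ℕ.z≤n) 2≤d)

    2≤d^ : ∀ {p} → 1 ≤ p → 2 ≤ d ^ p
    2≤d^ {p} 1≤p = ℕ.≤-trans 2≤d (subst (_≤ d ^ p) (ℕ.*-identityʳ d) (ℕ.^-monoʳ-≤ d 1≤p))

    defect-periodic : ∀ {H p} → (∀ h → H ≤ h → g (h ℕ.+ p) ≡ g h) →
                      ∀ k h → H ≤ h → defect k (h ℕ.+ p) ≡ defect k h
    defect-periodic periodic zero    h H≤h = refl
    defect-periodic {H} {p} periodic (suc k) h H≤h = cong₂ (λ c y → d ℕ.* c ℕ.+ y)
      (defect-periodic periodic k h H≤h)
      (trans (cong g (lemma h p k)) (periodic (h ℕ.+ k) (ℕ.m≤n⇒m≤n+o k H≤h)))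
      where
      lemma : ∀ h p k → h ℕ.+ p ℕ.+ k ≡ h ℕ.+ k ℕ.+ p
      lemma = solve-∀

  -- Along `h₀ + k * p` every period applies the same map, with slope `d ^ p`. The distance of `z`
  -- from its fixed point `b` is therefore multiplied by `d ^ p` each time, and `c` is chosen to fit
  -- the initial value.
  recurrence-formula : ∀ {H p} → 1 ≤ p → (∀ h → H ≤ h → g (h ℕ.+ p) ≡ g h) → ∀ h₀ → H ≤ h₀ →
    Σ[ c ∈ ℚ ] Σ[ b ∈ ℚ ] (∀ k → fromℕ (z (h₀ ℕ.+ k ℕ.* p)) ≡ c * fromℕ (d ^ (h₀ ℕ.+ k ℕ.* p)) + b)
  recurrence-formula {H} {p} 1≤p periodic h₀ H≤h₀
    -- `suc E` is `d ^ p - 1` and `suc F` is `d ^ h₀`; as explicit successors they can serve as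
    -- denominators.
    with E , E≡ ← ℕ.m≤n⇒∃[o]m+o≡n (2≤d^ 1≤p) | F , F≡ ← ℕ.m≤n⇒∃[o]m+o≡n (ℕ.m^n>0 d h₀) =
    c , b , formula
    where
    C : ℕ
    C = defect p h₀

    -- b is the fixed point of y ↦ d ^ p * y + C.
    b c : ℚ
    b = ℚ.- (fromℕ C * (ℤ.+ 1 ℚ./ suc E))
    c = (fromℕ (z h₀) ℚ.- b) * (ℤ.+ 1 ℚ./ suc F)

    b-fixed : fromℕ (d ^ p) * b + fromℕ C ≡ b
    b-fixed = begin
      fromℕ (d ^ p) * b + fromℕ C
        ≡⟨ cong (λ D → D * b + fromℕ C) (trans (cong fromℕ (sym E≡)) (fromℕ-homo-+ 1 (suc E))) ⟩
      (ℚ.1ℚ + fromℕ (suc E)) * b + fromℕ C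
        ≡⟨ lemma (fromℕ (suc E)) (fromℕ C) (ℤ.+ 1 ℚ./ suc E) ⟩
      b + fromℕ C * (ℚ.1ℚ ℚ.- fromℕ (suc E) * (ℤ.+ 1 ℚ./ suc E))
        ≡⟨ cong (λ y → b + fromℕ C * (ℚ.1ℚ ℚ.- y)) (fromℕ-inverse E) ⟩
      b + fromℕ C * (ℚ.1ℚ ℚ.- ℚ.1ℚ)
        ≡⟨ cong (b ℚ.+_) (ℚ.*-zeroʳ (fromℕ C)) ⟩
      b + ℚ.0ℚ
        ≡⟨ ℚ.+-identityʳ b ⟩
      b ∎
      where
      lemma : ∀ e c i → (ℚ.1ℚ + e) * (ℚ.- (c * i)) + c ≡
                        ℚ.- (c * i) + c * (ℚ.1ℚ ℚ.- e * i)
      lemma = +-*-Solver.solve 3 (λ e c i → (con ℚ.1ℚ :+ e) :* (:- (c :* i)) :+ c :=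
                                  :- (c :* i) :+ c :* (con ℚ.1ℚ :- e :* i)) refl

    initial : fromℕ (z h₀) ≡ c * fromℕ (d ^ h₀) + b
    initial = sym (begin
      (fromℕ (z h₀) ℚ.- b) * (ℤ.+ 1 ℚ./ suc F) * fromℕ (d ^ h₀) + b
        ≡⟨ cong (λ D → (fromℕ (z h₀) ℚ.- b) * (ℤ.+ 1 ℚ./ suc F) * fromℕ D + b) (sym F≡) ⟩
      (fromℕ (z h₀) ℚ.- b) * (ℤ.+ 1 ℚ./ suc F) * fromℕ (suc F) + b
        ≡⟨ lemma (fromℕ (z h₀)) b (ℤ.+ 1 ℚ./ suc F) (fromℕ (suc F)) ⟩
      (fromℕ (z h₀) ℚ.- b) * (fromℕ (suc F) * (ℤ.+ 1 ℚ./ suc F)) + b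
        ≡⟨ cong (λ y → (fromℕ (z h₀) ℚ.- b) * y + b) (fromℕ-inverse F) ⟩
      (fromℕ (z h₀) ℚ.- b) * ℚ.1ℚ + b
        ≡⟨ lemma′ (fromℕ (z h₀)) b ⟩
      fromℕ (z h₀) ∎)
      where
      lemma : ∀ y b i f → (y ℚ.- b) * i * f + b ≡ (y ℚ.- b) * (f * i) + b
      lemma = +-*-Solver.solve 4 (λ y b i f → (y :- b) :* i :* f :+ b := (y :- b) :* (f :* i) :+ b) refl
      lemma′ : ∀ y b → (y ℚ.- b) * ℚ.1ℚ + b ≡ y
      lemma′ = +-*-Solver.solve 2 (λ y b → (y :- b) :* con ℚ.1ℚ :+ b := y) refl

    formula : ∀ k → fromℕ (z (h₀ ℕ.+ k ℕ.* p)) ≡ c * fromℕ (d ^ (h₀ ℕ.+ k ℕ.* p)) + b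
    formula zero = subst (λ h → fromℕ (z h) ≡ c * fromℕ (d ^ h) + b) (sym (ℕ.+-identityʳ h₀)) initial
    formula (suc k) = begin
      fromℕ (z (h₀ ℕ.+ suc k ℕ.* p))
        ≡⟨ cong (fromℕ ∘ z) h+p≡ ⟩
      fromℕ (z (h ℕ.+ p))
        ≡⟨ cong fromℕ (z-+ h p) ⟩
      fromℕ (d ^ p ℕ.* z h ℕ.+ defect p h)
        -- `defect p` repeats with period `p`, so the constant of this period is the `C` of the
        -- first one.
        ≡⟨ cong (λ C → fromℕ (d ^ p ℕ.* z h ℕ.+ C))
             (shift {s = defect p} (defect-periodic periodic p) k h₀ H≤h₀) ⟩
      fromℕ (d ^ p ℕ.* z h ℕ.+ C)
        ≡⟨ trans (fromℕ-homo-+ (d ^ p ℕ.* z h) C) (cong (_+ fromℕ C) (fromℕ-homo-* (d ^ p) (z h))) ⟩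
      fromℕ (d ^ p) * fromℕ (z h) + fromℕ C
        ≡⟨ cong (λ y → fromℕ (d ^ p) * y + fromℕ C) (formula k) ⟩
      fromℕ (d ^ p) * (c * fromℕ (d ^ h) + b) + fromℕ C
        ≡⟨ lemma (fromℕ (d ^ p)) c (fromℕ (d ^ h)) b (fromℕ C) ⟩
      c * (fromℕ (d ^ h) * fromℕ (d ^ p)) + (fromℕ (d ^ p) * b + fromℕ C)
        ≡⟨ cong₂ (λ y b → c * y + b) (fromℕ-homo-* (d ^ h) (d ^ p)) (sym b-fixed) ⟨
      c * fromℕ (d ^ h ℕ.* d ^ p) + b
        ≡⟨ cong (λ D → c * fromℕ D + b) (trans (cong (d ^_) h+p≡) (ℕ.^-distribˡ-+-* d h p)) ⟨
      c * fromℕ (d ^ (h₀ ℕ.+ suc k ℕ.* p)) + b ∎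
      where
      h : ℕ
      h = h₀ ℕ.+ k ℕ.* p

      h+p≡ : h₀ ℕ.+ suc k ℕ.* p ≡ h ℕ.+ p
      h+p≡ = trans (cong (h₀ ℕ.+_) (ℕ.+-comm p (k ℕ.* p))) (sym (ℕ.+-assoc h₀ (k ℕ.* p) p))

      lemma : ∀ D c y b C → D * (c * y + b) + C ≡ c * (y * D) + (D * b + C)
      lemma = +-*-Solver.solve 5 (λ D c y b C → D :* (c :* y :+ b) :+ C :=
                                  c :* (y :* D) :+ (D :* b :+ C)) refl

-- Complete trees

ifα : Direction → ℕ → ℕ
ifα α-const   n = n
ifα β-const   n = 0
ifα sum-const n = 0

module _ (d-1 : ℕ) (a : ℕ → 𝔽₂) where

  private
    d : ℕ
    d = suc d-1

    ε : (h : ℕ) → Labeling (complete d h)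
    ε h = depthLabeling a (complete d h)

  line : ℕ → Line
  line zero    = graph (a 0) , a 0
  line (suc h) = step (parityOf d) (a (suc h)) (line h)

  root-label : ∀ h → ε h root ≡ a h
  root-label h = cong a (height-complete d-1 h)

  -- Induction on the height: a solution restricts to the children, with `β` as their `α`, and
  -- solutions for the children glue along a root of value `β`.
  solvable⇔on-line : ∀ h μ α β → (∃[ x ] Solves (ε h) μ α β x) ⇔ (μ , α , β) On line h
  solvable⇔on-line zero μ α β = mk⇔
    (λ { (x , solves@(_ , refl)) →
         to (leaf-equation (a 0) μ α β) (proj₂ (to (solves-node (ε 0) μ α x) solves)) })
    (λ on → (λ _ → β) ,
         from (solves-node (ε 0) μ α (λ _ → β)) ((λ ()) , from (leaf-equation (a 0) μ α β) on))
  solvable⇔on-line (suc h) μ α β = mk⇔ on solvable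
    where
    on : (∃[ x ] Solves (ε (suc h)) μ α β x) → (μ , α , β) On line (suc h)
    on (x , solves@(_ , refl)) with below , eq ← to (solves-node (ε (suc h)) μ α x) solves =
      to (step-correct d-1 (a (suc h)) (line h) μ α β)
        ( (λ i → x (child i root))
        , (λ i → to (solvable⇔on-line h μ β (x (child i root))) (x ∘ child i , below i))
        , trans eq (cong (λ s → sum (λ i → x (child i root)) ℙ.+ (s ℙ.* (μ ℙ.+ β))) (root-label (suc h))))

    solvable : (μ , α , β) On line (suc h) → ∃[ x ] Solves (ε (suc h)) μ α β x
    solvable on with βs , on-line , eq ← from (step-correct d-1 (a (suc h)) (line h) μ α β) on =
      x , from (solves-node (ε (suc h)) μ α x)
        ( (λ i → proj₁ (proj₂ (below i)) , refl)
        , trans eq (cong₂ ℙ._+_ (sum-cong-≗ (λ i → sym (proj₂ (proj₂ (below i)))))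
                                (cong (ℙ._* (μ ℙ.+ β)) (sym (root-label (suc h))))))
      where
      below : ∀ i → ∃[ y ] Solves (ε h) μ β (βs i) y
      below i = from (solvable⇔on-line h μ β (βs i)) (on-line i)

      x : Vector (complete d (suc h))
      x root        = β
      x (child i v) = proj₁ (below i) v

  -- Dimensions of the kernels for complete trees

  direction : ℕ → Direction
  direction h = proj₁ (line h)

  rootedNullity : ℕ → ℕ
  rootedNullity zero    = 0
  rootedNullity (suc h) = d ℕ.* rootedNullity h ℕ.+ ifα (direction h) d-1

  copies⊆rootedKer : ∀ h {x} → Copies d (RootedKer (ε h)) x → RootedKer (ε (suc h)) x
  copies⊆rootedKer h (x-root , below) = from (rootedKer-node (ε (suc h)))
    (x-root , proj₁ ∘ below , sum-zero _ (proj₂ ∘ below))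

  -- With `μ = α = 0` the forms of the other two directions both reduce to `β`, and the line forces
  -- it to be zero.
  ker-root : ∀ h → direction h ≢ α-const → ∀ {x} → ker (M _ (ε h)) x → x root ≡ 0ℙ
  ker-root h dir≢α {x} Mx≗𝟎 =
    on-line (line h) dir≢α (to (solvable⇔on-line h 0ℙ 0ℙ (x root)) (x , Mx≗𝟎 , refl))
    where
    on-line : ∀ l {β} → proj₁ l ≢ α-const → (0ℙ , 0ℙ , β) On l → β ≡ 0ℙ
    on-line (α-const   , _) dir≢α _  = contradiction refl dir≢α
    on-line (β-const   , _) _     on = on
    on-line (sum-const , _) _     on = on

  -- With `μ = α = 0` the equation of the line reads `0 = 0`, so root value 1 is attained.
  α-const-ker : ∀ h → direction h ≡ α-const → ∃[ w ] ker (M _ (ε h)) w × w root ≡ 1ℙ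
  α-const-ker h dir≡α = from (solvable⇔on-line h 0ℙ 0ℙ 1ℙ) (on-line (line h) dir≡α)
    where
    on-line : ∀ l → proj₁ l ≡ α-const → (0ℙ , 0ℙ , 1ℙ) On l
    on-line (α-const , _) refl = refl

  rootedKer-copies : ∀ h → direction h ≢ α-const → Copies d (RootedKer (ε h)) ≐ RootedKer (ε (suc h))
  rootedKer-copies h dir≢α = copies⊆rootedKer h , λ x∈ →
    let x-root , below , _ = to (rootedKer-node (ε (suc h))) x∈
    in x-root , λ i → below i , ker-root h dir≢α (below i)

  -- It suffices to test `d-1` of the children, since the sum condition then forces the root value
  -- of the first child to vanish.
  copies-vanishing : ∀ h → Copies d (RootedKer (ε h)) ≐
    Vanishing (RootedKer (ε (suc h))) (λ (j : Fin d-1) → child (suc j) root)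
  copies-vanishing h = (λ x∈ → copies⊆rootedKer h x∈ , proj₂ ∘ proj₂ x∈ ∘ suc) , vanishing⊆copies
    where
    vanishing⊆copies : ∀ {x} → Vanishing (RootedKer (ε (suc h))) (λ (j : Fin d-1) → child (suc j) root) x →
                       Copies d (RootedKer (ε h)) x
    vanishing⊆copies {x} (x∈ , vanish) with x-root , below , sum≡0 ← to (rootedKer-node (ε (suc h))) x∈ =
      x-root , λ { zero → below zero , first ; (suc j) → below (suc j) , vanish j }
      where
      first : x (child zero root) ≡ 0ℙ
      first = begin
        x (child zero root)
          ≡⟨ ℙ.+-identityʳ _ ⟨
        x (child zero root) ℙ.+ 0ℙ
          ≡⟨ cong (x (child zero root) ℙ.+_) (sum-zero _ vanish) ⟨
        sum (λ i → x (child i root))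
          ≡⟨ sum≡0 ⟩
        0ℙ ∎

  rootedKer-dimension : ∀ h → HasDimension (RootedKer (ε h)) (rootedNullity h)
  rootedKer-dimension zero = (λ ()) , record
    { belongs     = λ ()
    ; independent = λ _ _ ()
    ; spans       = λ { x (_ , x-root) → (λ ()) , λ { root → sym x-root } }
    }
  rootedKer-dimension (suc h) with copies-dimension d (rootedKer-isSubspace (ε h)) (rootedKer-dimension h)
                                 | direction h in eq
  ... | copies | β-const   = subst (HasDimension _) (sym (ℕ.+-identityʳ _))
    (dimension-≐ (rootedKer-copies h λ eq′ → contradiction (trans (sym eq) eq′) λ ()) copies)
  ... | copies | sum-const = subst (HasDimension _) (sym (ℕ.+-identityʳ _))
    (dimension-≐ (rootedKer-copies h λ eq′ → contradiction (trans (sym eq) eq′) λ ()) copies)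
  ... | copies | α-const   with w , Mw≗𝟎 , w-root ← α-const-ker h eq =
    adjoin (rootedKer-isSubspace (ε (suc h))) (λ j → child (suc j) root)
      (dimension-≐ (copies-vanishing h) copies) v v∈ dual
    where
    open IsSubspace (ker-isSubspace (M _ (ε h)))

    -- Placing `w` in two children cancels the sum of root values. The first child is common to all
    -- `v j`, so the roots of the other children give the dual evaluations.
    v : Fin d-1 → Vector (complete d (suc h))
    v j = embed zero w ⊕ embed (suc j) w

    v∈ : ∀ j → RootedKer (ε (suc h)) (v j)
    v∈ j = from (rootedKer-node (ε (suc h)))
      ( refl
      , (λ i → ⊕-closed (·-closed ⟦ zero Fin.≟ i ⟧ Mw≗𝟎) (·-closed ⟦ suc j Fin.≟ i ⟧ Mw≗𝟎))
      , (begin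
          sum (λ i → embed zero w (child i root) ℙ.+ embed (suc j) w (child i root))
            ≡⟨ ∑-distrib-+ {d} (λ i → embed zero w (child i root)) (λ i → embed (suc j) w (child i root)) ⟩
          sum (λ i → embed {d} zero w (child i root)) ℙ.+ sum (λ i → embed (suc j) w (child i root))
            ≡⟨ cong₂ ℙ._+_ (sum-embed-root {d} zero w) (sum-embed-root (suc j) w) ⟩
          w root ℙ.+ w root
            ≡⟨ ℙ.p+p≡0ℙ (w root) ⟩
          0ℙ ∎))

    dual : ∀ i j → v i (child (suc j) root) ≡ ⟦ i Fin.≟ j ⟧
    dual i j = trans (cong (⟦ i Fin.≟ j ⟧ ℙ.*_) w-root) (ℙ.*-identityʳ ⟦ i Fin.≟ j ⟧)

  -- For an `α-const` line one kernel vector with root value 1 complements `RootedKer`; otherwise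
  -- the two spaces coincide.
  nullity : ∀ h → Nullity (M _ (ε h)) (rootedNullity h ℕ.+ ifα (direction h) 1)
  nullity h with rootedKer-dimension h | direction h in eq
  ... | rooted | β-const   = subst (HasDimension _) (sym (ℕ.+-identityʳ _)) (dimension-≐
    (proj₁ , λ Mx≗𝟎 → Mx≗𝟎 , ker-root h (λ eq′ → contradiction (trans (sym eq) eq′) λ ()) Mx≗𝟎) rooted)
  ... | rooted | sum-const = subst (HasDimension _) (sym (ℕ.+-identityʳ _)) (dimension-≐
    (proj₁ , λ Mx≗𝟎 → Mx≗𝟎 , ker-root h (λ eq′ → contradiction (trans (sym eq) eq′) λ ()) Mx≗𝟎) rooted)
  ... | rooted | α-const   with w , Mw≗𝟎 , w-root ← α-const-ker h eq =
    adjoin (ker-isSubspace (M _ (ε h))) (λ _ → root) (dimension-≐ (ker-vanishing-at-root (ε h)) rooted)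
      (λ _ → w) (λ _ → Mw≗𝟎) λ { zero zero → w-root }

  -- Periodicity of the boundary subspaces

  line-eventuallyPeriodic : EventuallyPeriodic _≡_ a → EventuallyPeriodic _≡_ line
  line-eventuallyPeriodic =
    automaton-eventuallyPeriodic encodeLine encodeLine-injective (step (parityOf d)) a line (λ _ → refl)

  L⇔on-line : ∀ h {α β} → L (complete d h) (ε h) (α , β) ⇔ (1ℙ , α , β) On line h
  L⇔on-line h {α} {β} = solvable⇔on-line h 1ℙ α β ⇔-∘ L⇔solvable (ε h) α β

  L-cong : ∀ h h′ → line h ≡ line h′ → L (complete d h) (ε h) ≐ L (complete d h′) (ε h′)
  L-cong h h′ eq =
      (λ { {α , β} → from (L⇔on-line h′) ∘ subst ((1ℙ , α , β) On_) eq ∘ to (L⇔on-line h) })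
    , (λ { {α , β} → from (L⇔on-line h) ∘ subst ((1ℙ , α , β) On_) (sym eq) ∘ to (L⇔on-line h′) })

  -- Nullities along a residue class

  module _ (2≤d : 2 ≤ d) {H p : ℕ} (1≤p : 1 ≤ p) (periodic : ∀ h → H ≤ h → line (h ℕ.+ p) ≡ line h)
           (r : Fin p) where

    private
      base : ℕ
      base = toℕ r ℕ.+ H ℕ.* p

      H≤base : H ≤ base
      H≤base = ℕ.≤-trans (ℕ.m≤m*n H p {{ℕ.>-nonZero 1≤p}}) (ℕ.m≤n+m (H ℕ.* p) (toℕ r))

      -- The threshold `suc H * p` is the same for all residues and exceeds every `base`, because
      -- `r < p`. It also ensures `r ≤ h`, which removes the absolute value from the congruence.
      from-base : ∀ h → suc H ℕ.* p ≤ h → h ≡ toℕ r mod p → ∃[ k ] base ℕ.+ k ℕ.* p ≡ h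
      from-base h h₀≤h (divides m ∣h-r∣≡mp) =
        let k , H+k≡m = ℕ.m≤n⇒∃[o]m+o≡n H≤m
        in k , trans (lemma (toℕ r) H k p) (trans (cong (λ m → toℕ r ℕ.+ m ℕ.* p) H+k≡m) h≡)
        where
        base≤h : base ≤ h
        base≤h = ℕ.≤-trans (ℕ.+-monoˡ-≤ (H ℕ.* p) (ℕ.<⇒≤ (Fin.toℕ<n r))) h₀≤h

        r≤h : toℕ r ≤ h
        r≤h = ℕ.≤-trans (ℕ.m≤m+n (toℕ r) (H ℕ.* p)) base≤h

        h≡ : toℕ r ℕ.+ m ℕ.* p ≡ h
        h≡ = trans (cong (toℕ r ℕ.+_) (trans (sym ∣h-r∣≡mp) (ℕ.m≤n⇒∣n-m∣≡n∸m r≤h))) (ℕ.m+[n∸m]≡n r≤h)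

        H≤m : H ≤ m
        H≤m = ℕ.*-cancelʳ-≤ H m p {{ℕ.>-nonZero 1≤p}}
                (ℕ.+-cancelˡ-≤ (toℕ r) _ _ (subst (base ≤_) (sym h≡) base≤h))

        lemma : ∀ r H k p → r ℕ.+ H ℕ.* p ℕ.+ k ℕ.* p ≡ r ℕ.+ (H ℕ.+ k) ℕ.* p
        lemma = solve-∀

      excess : ℕ → ℕ
      excess h = ifα (direction h) 1

    -- Both the inhomogeneity of the recurrence and `excess` depend only on the line. The latter is
    -- constant along the class and is absorbed into the additive constant.
    nullity-residue : Σ[ c ∈ ℚ ] Σ[ b ∈ ℚ ] (∀ h → suc H ℕ.* p ≤ h → h ≡ toℕ r mod p →
      ∃[ n ] Nullity (M (complete d h) (ε h)) n × fromℕ n ≡ c * fromℕ (d ^ h) + b)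
    nullity-residue with c , b , z-formula ← recurrence-formula d 2≤d rootedNullity _ (λ _ → refl) 1≤p
                     (λ h H≤h → cong (λ l → ifα (proj₁ l) d-1) (periodic h H≤h)) base H≤base =
      c , b + fromℕ (excess base) , λ h h₀≤h h≡r →
      rootedNullity h ℕ.+ excess h , nullity h , at-residue h (from-base h h₀≤h h≡r)
      where
      at-residue : ∀ h → ∃[ k ] base ℕ.+ k ℕ.* p ≡ h →
        fromℕ (rootedNullity h ℕ.+ excess h) ≡ c * fromℕ (d ^ h) + (b + fromℕ (excess base))
      at-residue h (k , refl) = begin
        fromℕ (rootedNullity h ℕ.+ excess h)
          ≡⟨ fromℕ-homo-+ (rootedNullity h) (excess h) ⟩
        fromℕ (rootedNullity h) + fromℕ (excess h)
          ≡⟨ cong₂ ℚ._+_ (z-formula k) (cong (λ l → fromℕ (ifα (proj₁ l) 1))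
               (shift {s = line} periodic k base H≤base)) ⟩
        c * fromℕ (d ^ h) + b + fromℕ (excess base)
          ≡⟨ ℚ.+-assoc (c * fromℕ (d ^ h)) b (fromℕ (excess base)) ⟩
        c * fromℕ (d ^ h) + (b + fromℕ (excess base)) ∎

theorem5p2 : (d : ℕ) → 2 ≤ d →
    (a : ℕ → 𝔽₂) → EventuallyPeriodic _≡_ a →
    let T : ℕ → Tree
        T h = complete d h
        ε : (h : ℕ) → Labeling (T h)
        ε h = depthLabeling a (T h)
    in
    EventuallyPeriodic _≐_ (λ h → L (T h) (ε h))
    × (∃[ h₀ ] ∃[ p ] 1 ≤ p ×
        ((r : Fin p) → Σ[ c ∈ ℚ ] Σ[ b ∈ ℚ ]
          (∀ h → h₀ ≤ h → h ≡ toℕ r mod p →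
            ∃[ n ] Nullity (M (T h) (ε h)) n × fromℕ n ≡ c * fromℕ (d ^ h) + b)))
theorem5p2 (suc d-1) 2≤d a a-periodic =
  let H , p , 1≤p , periodic = line-eventuallyPeriodic d-1 a a-periodic
  in  (H , p , 1≤p , λ h H≤h → L-cong d-1 a (h ℕ.+ p) h (periodic h H≤h))
    , (suc H ℕ.* p , p , 1≤p , nullity-residue d-1 a 2≤d 1≤p periodic)
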